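{- Let $G_1$ and $G_2$ be finite simple connected graphs, where $G_1$ has at least one edge (so that the subdivision-edge join $G_1\veebar G_2$ is connected). Then the eccentricity matrix $\epsilon(G_1\veebar G_2)$ is irreducible.
   Context: All graphs are finite, simple and undirected. The subdivision graph $S(G)$ of a graph $G$ is obtained from $G$ by subdividing each edge with one new vertex; $I(G)$ is the set of these new vertices, so $V(S(G))=V(G)\cup I(G)$. For vertex-disjoint graphs $G_1,G_2$, the subdivision-edge join $G_1\veebar G_2$ is obtained from $S(G_1)$ and $G_2$ by joining each vertex of $I(G_1)$ to every vertex of $V(G_2)$ (the vertices of $V(G_1)$ receive no new edges). For a connected graph $G$ with distance function $d$, the eccentricity of a vertex $v$ is $e(v)=\max\{d(v,u):u\in V(G)\}$. The eccentricity matrix $\epsilon(G)$ is the symmetric matrix indexed by $V(G)$ with $(u,v)$ entry $d(u,v)$ if $d(u,v)=\min\{e(u),e(v)\}$, and $0$ otherwise. A square matrix $N$ is reducible if there is a permutation matrix $P$ with $N=P^T\begin{pmatrix}A&B\\0&C\end{pmatrix}P$, where $A$ and $C$ are (nonempty) square blocks; it is irreducible otherwise. -}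

{-# OPTIONS --safe #-}
module Defs where

open import Algebra.Properties.Semiring.Sum using (sum)
open import Data.Bool using (if_then_else_)
open import Data.Empty using (⊥)
open import Data.Fin as Fin using (Fin)
open import Data.Fin.Permutation using (Permutation′; _⟨$⟩ʳ_)
open import Data.Fin.Properties using (any?; inj⇒≟; +↔⊎; <-cmp)
open import Data.Integer as ℤ using (ℤ; +_; 0ℤ; 1ℤ)
import Data.Integer.Properties as ℤ
open import Data.List using (List; allFin; cartesianProduct; filter; length; lookup; map)
open import Data.List.Extrema.Nat using (max)
open import Data.List.Membership.Propositional using (_∈_)
open import Data.List.Membership.Propositional.Properties
  using (∈-allFin; ∈-cartesianProduct⁺; ∈-filter⁺)
open import Data.List.Relation.Unary.Any using (index)
open import Data.List.Relation.Unary.Any.Properties using (lookup-index)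
open import Data.Nat using (ℕ; zero; suc; _+_; _≤_; _⊓_; z≤n; s≤s; NonZero)
import Data.Nat.Properties as ℕ
open import Data.Product using (Σ-syntax; ∃; ∃-syntax; _×_; _,_; proj₁; proj₂)
open import Data.Sum using (_⊎_; inj₁; inj₂)
open import Data.Sum.Function.Propositional using (_⊎-↔_)
open import Data.Unit using (⊤; tt)
open import Data.Vec.Functional using (Vector; transpose; _++_)
open import Function using (_∘_; _↔_; Inverse)
open import Function.Construct.Composition using (_↔-∘_)
open import Function.Construct.Identity using (↔-id)
open import Function.Construct.Symmetry using (↔-sym)
open import Function.Properties.Inverse using (↔⇒↣)
open import Level using (0ℓ)
open import Relation.Binary using (Rel; Decidable; DecidableEquality; Symmetric; Irreflexive)
open import Relation.Binary.Definitions using (tri<; tri≈; tri>)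
open import Relation.Binary.PropositionalEquality using (_≡_; refl; sym; trans; cong; subst; subst₂)
open import Relation.Nullary using (Dec; yes; no; ¬_; does; contradiction)
open import Relation.Nullary.Decidable using (map′; _×-dec_; _⊎-dec_)
open import Relation.Unary using (Pred)
import Relation.Unary as U

------------------------------------------------------------------------
-- Graphs

-- A finite graph comes with a numbering of its vertices and decidable
-- adjacency; nothing below depends on the numbering except the order in
-- which vertices and edges are listed.
record Graph : Set₁ where
  field
    Vertex : Set
    order  : ℕ
    enum   : Fin order ↔ Vertex
    Adj    : Rel Vertex 0ℓ
    adj?   : Decidable Adj
    symm   : Symmetric Adj
    irrefl : Irreflexive _≡_ Adj

  vertex : Fin order → Vertex
  vertex = Inverse.to enum

  number : Vertex → Fin order
  number = Inverse.from enum

  vertex-number : ∀ v → vertex (number v) ≡ v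
  vertex-number = Inverse.strictlyInverseˡ enum

  _≟_ : DecidableEquality Vertex
  _≟_ = inj⇒≟ (↔⇒↣ (↔-sym enum))

  anyVertex? : {P : Pred Vertex 0ℓ} → U.Decidable P → Dec (∃ P)
  anyVertex? {P} P? = map′ (λ (i , p) → vertex i , p)
                           (λ (v , p) → number v , subst P (sym (vertex-number v)) p)
                           (any? (P? ∘ vertex))

open Graph using (Vertex; order; Adj)

HasEdge : Graph → Set
HasEdge G = ∃[ u ] ∃[ v ] Adj G u v

Walk : (G : Graph) → Vertex G → Vertex G → ℕ → Set
Walk G u v zero    = u ≡ v
Walk G u v (suc k) = ∃[ w ] (Adj G u w × Walk G w v k)

-- The graph without vertices is not connected.
Connected : Graph → Set
Connected G = Vertex G × (∀ u v → ∃[ k ] Walk G u v k)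

------------------------------------------------------------------------
-- The subdivision graph and the subdivision-edge join

module _ (G : Graph) where
  open Graph G hiding (Vertex; order; Adj)

  -- Each unordered pair {u , v} of adjacent vertices is listed exactly
  -- once, as (u , v) with u numbered before v.
  IsEdge : Fin (order G) × Fin (order G) → Set
  IsEdge (i , j) = i Fin.< j × Adj G (vertex i) (vertex j)

  isEdge? : U.Decidable IsEdge
  isEdge? (i , j) = (i Fin.<? j) ×-dec adj? (vertex i) (vertex j)

  edges : List (Fin (order G) × Fin (order G))
  edges = filter isEdge? (cartesianProduct (allFin (order G)) (allFin (order G)))

  -- I(G)
  Edge : Set
  Edge = Fin (length edges)

  end₁ end₂ : Edge → Vertex G
  end₁ e = vertex (proj₁ (lookup edges e))
  end₂ e = vertex (proj₂ (lookup edges e))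

  Incident : Vertex G → Edge → Set
  Incident v e = v ≡ end₁ e ⊎ v ≡ end₂ e

  incident? : Decidable Incident
  incident? v e = (v ≟ end₁ e) ⊎-dec (v ≟ end₂ e)

Subdivision : Graph → Graph
Subdivision G = record
  { Vertex = V
  ; order  = order G + length (edges G)
  ; enum   = (Graph.enum G ⊎-↔ ↔-id _) ↔-∘ +↔⊎
  ; Adj    = A
  ; adj?   = A?
  ; symm   = λ {x} {y} → A-sym x y
  ; irrefl = λ { {inj₁ _} refl () ; {inj₂ _} refl () }
  }
  where
  V : Set
  V = Vertex G ⊎ Edge G

  A : Rel V 0ℓ
  A (inj₁ u) (inj₁ v) = ⊥
  A (inj₁ v) (inj₂ e) = Incident G v e
  A (inj₂ e) (inj₁ v) = Incident G v e
  A (inj₂ e) (inj₂ f) = ⊥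

  A? : Decidable A
  A? (inj₁ u) (inj₁ v) = no λ ()
  A? (inj₁ v) (inj₂ e) = incident? G v e
  A? (inj₂ e) (inj₁ v) = incident? G v e
  A? (inj₂ e) (inj₂ f) = no λ ()

  A-sym : ∀ x y → A x y → A y x
  A-sym (inj₁ u) (inj₁ v) a = a
  A-sym (inj₁ v) (inj₂ e) a = a
  A-sym (inj₂ e) (inj₁ v) a = a
  A-sym (inj₂ e) (inj₂ f) a = a

infixr 6 _⊻_

_⊻_ : Graph → Graph → Graph
G₁ ⊻ G₂ = record
  { Vertex = V
  ; order  = order (Subdivision G₁) + order G₂
  ; enum   = (Graph.enum (Subdivision G₁) ⊎-↔ Graph.enum G₂) ↔-∘ +↔⊎
  ; Adj    = A
  ; adj?   = A?
  ; symm   = λ {x} {y} → A-sym x y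
  ; irrefl = λ { {inj₁ _} refl → Graph.irrefl (Subdivision G₁) refl
               ; {inj₂ _} refl → Graph.irrefl G₂ refl }
  }
  where
  V : Set
  V = (Vertex G₁ ⊎ Edge G₁) ⊎ Vertex G₂

  A : Rel V 0ℓ
  A (inj₁ x)        (inj₁ y)        = Adj (Subdivision G₁) x y
  A (inj₁ (inj₁ v)) (inj₂ w)        = ⊥
  A (inj₁ (inj₂ e)) (inj₂ w)        = ⊤
  A (inj₂ w)        (inj₁ (inj₁ v)) = ⊥
  A (inj₂ w)        (inj₁ (inj₂ e)) = ⊤
  A (inj₂ w)        (inj₂ z)        = Adj G₂ w z

  A? : Decidable A
  A? (inj₁ x)        (inj₁ y)        = Graph.adj? (Subdivision G₁) x y
  A? (inj₁ (inj₁ v)) (inj₂ w)        = no λ ()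
  A? (inj₁ (inj₂ e)) (inj₂ w)        = yes tt
  A? (inj₂ w)        (inj₁ (inj₁ v)) = no λ ()
  A? (inj₂ w)        (inj₁ (inj₂ e)) = yes tt
  A? (inj₂ w)        (inj₂ z)        = Graph.adj? G₂ w z

  A-sym : ∀ x y → A x y → A y x
  A-sym (inj₁ x)        (inj₁ y)        a = Graph.symm (Subdivision G₁) {x} {y} a
  A-sym (inj₁ (inj₁ v)) (inj₂ w)        a = a
  A-sym (inj₁ (inj₂ e)) (inj₂ w)        a = a
  A-sym (inj₂ w)        (inj₁ (inj₁ v)) a = a
  A-sym (inj₂ w)        (inj₁ (inj₂ e)) a = a
  A-sym (inj₂ w)        (inj₂ z)        a = Graph.symm G₂ a

------------------------------------------------------------------------
-- Distance, eccentricity and the eccentricity matrix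

Least : Pred ℕ 0ℓ → Pred ℕ 0ℓ
Least P k = P k × (∀ j → P j → k ≤ j)

least : {P : Pred ℕ 0ℓ} → U.Decidable P → ∀ k → P k → ∃ (Least P)
least P? zero p = zero , p , λ _ _ → z≤n
least {P} P? (suc k) p with P? zero
... | yes p₀ = zero , p₀ , λ _ _ → z≤n
... | no ¬p₀ with least {P ∘ suc} (P? ∘ suc) k p
...   | m , pₘ , m≤ = suc m , pₘ , λ where
        zero    p₀ → contradiction p₀ ¬p₀
        (suc j) pⱼ → s≤s (m≤ j pⱼ)

walk? : (G : Graph) → ∀ u v → U.Decidable (Walk G u v)
walk? G u v zero    = Graph._≟_ G u v
walk? G u v (suc k) = Graph.anyVertex? G λ w → Graph.adj? G u w ×-dec walk? G w v k

SquareMatrix : ℕ → Set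
SquareMatrix n = Vector (Vector ℤ n) n

module _ (G : Graph) (conn : Connected G) where
  open Graph G using (vertex)

  -- The least length of a walk from u to v.
  dist : Vertex G → Vertex G → ℕ
  dist u v = let k , walk = proj₂ conn u v in proj₁ (least (walk? G u v) k walk)

  ecc : Vertex G → ℕ
  ecc v = max 0 (map (dist v ∘ vertex) (allFin (order G)))

  eccEntry : Vertex G → Vertex G → ℤ
  eccEntry u v = if does (dist u v ℕ.≟ ecc u ⊓ ecc v) then + dist u v else 0ℤ

  ε : SquareMatrix (order G)
  ε i j = eccEntry (vertex i) (vertex j)

------------------------------------------------------------------------
-- Reducible and irreducible matrices

infixl 7 _*ᴹ_
infix  8 _ᵀ

_*ᴹ_ : ∀ {n} → SquareMatrix n → SquareMatrix n → SquareMatrix n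
(M *ᴹ N) i j = sum ℤ.+-*-semiring (λ k → M i k ℤ.* N k j)

_ᵀ : ∀ {n} → SquareMatrix n → SquareMatrix n
M ᵀ = transpose M

permutationMatrix : ∀ {n} → Permutation′ n → SquareMatrix n
permutationMatrix π i j = if does ((π ⟨$⟩ʳ i) Fin.≟ j) then 1ℤ else 0ℤ

--  A B
--  0 C
blockTriangular : ∀ {p q} → SquareMatrix p → Vector (Vector ℤ q) p → SquareMatrix q →
                  SquareMatrix (p + q)
blockTriangular A B C = (λ i → A i ++ B i) ++ (λ i → (λ _ → 0ℤ) ++ C i)

data Reducible : ∀ {n} → SquareMatrix n → Set where
  reducible : ∀ {p q} .{{_ : NonZero p}} .{{_ : NonZero q}}
              (N : SquareMatrix (p + q)) (π : Permutation′ (p + q))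
              (A : SquareMatrix p) (B : Vector (Vector ℤ q) p) (C : SquareMatrix q) →
              (let P = permutationMatrix π) →
              (∀ i j → N i j ≡ (P ᵀ *ᴹ blockTriangular A B C *ᴹ P) i j) →
              Reducible N

Irreducible : ∀ {n} → SquareMatrix n → Set
Irreducible N = ¬ Reducible N

------------------------------------------------------------------------
-- Connectedness of the join

module _ {G : Graph} where

  _++ʷ_ : ∀ {u v w k l} → Walk G u v k → Walk G v w l → Walk G u w (k + l)
  _++ʷ_ {k = zero}  refl        q = q
  _++ʷ_ {k = suc k} (x , a , p) q = x , a , p ++ʷ q

  reverseʷ : ∀ {u v k} → Walk G u v k → ∃[ l ] Walk G v u l
  reverseʷ {k = zero}      refl        = 0 , refl
  reverseʷ {u} {k = suc k} (x , a , p) = _ , proj₂ (reverseʷ p) ++ʷ (u , Graph.symm G a , refl)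

module _ (G : Graph) where
  open Graph G using (vertex; number; vertex-number; symm; irrefl)

  private
    listed : ∀ {u v} → number u Fin.< number v → Adj G u v →
             Σ[ e ∈ Edge G ] (u ≡ end₁ G e × v ≡ end₂ G e)
    listed {u} {v} u<v a = index mem , via proj₁ refl , via proj₂ refl
      where
      mem : (number u , number v) ∈ edges G
      mem = ∈-filter⁺ (isEdge? G) (∈-cartesianProduct⁺ (∈-allFin _) (∈-allFin _))
              (u<v , subst₂ (Adj G) (sym (vertex-number u)) (sym (vertex-number v)) a)

      via : (f : Fin (order G) × Fin (order G) → Fin (order G)) →
            ∀ {x} → f (number u , number v) ≡ number x →
            x ≡ vertex (f (lookup (edges G) (index mem)))
      via f {x} eq = trans (sym (vertex-number x))
                         (cong vertex (trans (sym eq) (cong f (lookup-index mem))))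

  adj⇒edge : ∀ {u v} → Adj G u v → Σ[ e ∈ Edge G ] (Incident G u e × Incident G v e)
  adj⇒edge {u} {v} a with <-cmp (number u) (number v)
  ... | tri< u<v _ _ = let e , p , q = listed u<v a in e , inj₁ p , inj₂ q
  ... | tri> _ _ v<u = let e , p , q = listed v<u (symm a) in e , inj₂ q , inj₁ p
  ... | tri≈ _ u≡v _ = contradiction a
          (irrefl (trans (sym (vertex-number u)) (trans (cong vertex u≡v) (vertex-number v))))

  incidentEdge : Connected G → HasEdge G → ∀ v → Σ[ e ∈ Edge G ] Incident G v e
  incidentEdge (_ , walks) (a , b , ab) v with walks v a
  ... | zero  , refl        = let e , p , _ = adj⇒edge ab in e , p
  ... | suc _ , x , vx , _  = let e , p , _ = adj⇒edge vx in e , p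

⊻-connected : ∀ G₁ G₂ → Connected G₁ → Connected G₂ → HasEdge G₁ → Connected (G₁ ⊻ G₂)
⊻-connected G₁ G₂ c₁ (w , _) h@(_ , _ , ab) =
  inj₂ w , λ x y → _ , _++ʷ_ {J} (proj₂ (toW x)) (proj₂ (reverseʷ {J} (proj₂ (toW y))))
  where
  J = G₁ ⊻ G₂

  toW : ∀ x → ∃[ k ] Walk J x (inj₂ w) k
  toW (inj₁ (inj₁ v)) = let e , v∈e = incidentEdge G₁ c₁ h v in
                        2 , inj₁ (inj₂ e) , v∈e , inj₂ w , tt , refl
  toW (inj₁ (inj₂ e)) = 1 , inj₂ w , tt , refl
  toW (inj₂ z)        = 2 , inj₁ (inj₂ (proj₁ (adj⇒edge G₁ ab))) , tt , inj₂ w , tt , refl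

{-# OPTIONS --safe #-}
-- Every vertex of G₂ has distance 2 to every vertex of G₁, and all vertices
-- are within distance 2 of it.  A subdivision vertex e of G₁ has distance 3
-- to each vertex of G₁ not incident to it, and all vertices are within
-- distance 3 of it; if there is no such vertex, then G₁ = K₂ and e is
-- adjacent to all other vertices.  Pairs of distinct vertices u, v such that
-- v is farthest from u have nonzero entries in ε, so the graph of the nonzero
-- entries of ε is connected, which excludes a zero block.
module Submission where

open import Defs

open import Algebra.Properties.Semiring.Sum using (sum; sum-cong-≗; sum-replicate-zero)
open import Data.Bool using (Bool; true; false)
open import Data.Fin as Fin using (Fin; zero; suc; fromℕ<; _↑ˡ_; _↑ʳ_; splitAt)
open import Data.Fin.Permutation using (_⟨$⟩ʳ_; _⟨$⟩ˡ_; inverseˡ)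
open import Data.Fin.Properties using (splitAt-↑ˡ; splitAt-↑ʳ; <-asym; <-irrefl)
open import Data.Integer as ℤ using (0ℤ)
import Data.Integer.Properties as ℤ
open import Data.List using (List; _∷_; lookup; allFin; cartesianProduct)
open import Data.List.Extrema.Nat using (max≤v⁺; xs≤max)
open import Data.List.Membership.Propositional.Properties using (∈-allFin; ∈-lookup; ∈-filter⁻)
import Data.List.Relation.Unary.All as All
import Data.List.Relation.Unary.All.Properties as All
open import Data.List.Relation.Unary.AllPairs using (_∷_)
open import Data.List.Relation.Unary.Unique.Propositional using (Unique)
open import Data.List.Relation.Unary.Unique.Propositional.Properties
  using (allFin⁺; cartesianProduct⁺; filter⁺)
open import Data.Nat using (zero; suc; _+_; _≤_; _⊓_; z≤n; s≤s; >-nonZero⁻¹)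
import Data.Nat.Properties as ℕ
open import Data.Product using (Σ-syntax; ∃-syntax; _×_; _,_; proj₁; proj₂)
open import Data.Sum using (_⊎_; inj₁; inj₂; [_,_]′)
open import Data.Unit using (tt)
open import Function using (_∘_; const; Inverse)
open import Function.Properties.Inverse using (↔⇒↣)
open import Function.Bundles using (Injection)
open import Relation.Binary.Construct.Closure.Equivalence
  using (EqClosure; symmetric; transitive; return; gfold; gmap)
open import Relation.Binary.PropositionalEquality
  using (_≡_; _≢_; refl; sym; trans; cong; cong₂; subst; subst₂; isEquivalence)
open import Relation.Nullary using (¬_; yes; no; contradiction)
open import Relation.Nullary.Decidable using (dec-true; decidable-stable; ¬?)

open Graph using (Vertex; order; Adj; vertex; number; vertex-number)

sum-zero : ∀ {n} (t : Fin n → ℤ.ℤ) → (∀ i → t i ≡ 0ℤ) → sum ℤ.+-*-semiring t ≡ 0ℤ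
sum-zero {n} t t≡0 = trans (sum-cong-≗ ℤ.+-*-semiring t≡0) (sum-replicate-zero ℤ.+-*-semiring n)

-- Column `j` of the permutation matrix is nonzero only in the row that `π` sends to `j`, and
-- likewise for `i`, so the one surviving product contains the entry of `M` assumed to vanish.
conjugate-zero : ∀ {n} π (M : SquareMatrix n) {i j} → M (π ⟨$⟩ˡ i) (π ⟨$⟩ˡ j) ≡ 0ℤ →
  (permutationMatrix π ᵀ *ᴹ M *ᴹ permutationMatrix π) i j ≡ 0ℤ
conjugate-zero π M {i} {j} m = sum-zero _ column
  where
  P = permutationMatrix π

  row : ∀ k → π ⟨$⟩ʳ k ≡ j → ∀ l → P l i ℤ.* M l k ≡ 0ℤ
  row k refl l with (π ⟨$⟩ʳ l) Fin.≟ i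
  ... | no  _    = refl
  ... | yes refl = trans (ℤ.*-identityˡ _)
                     (subst₂ (λ a b → M a b ≡ 0ℤ) (inverseˡ π) (inverseˡ π) m)

  column : ∀ k → (P ᵀ *ᴹ M) i k ℤ.* P k j ≡ 0ℤ
  column k with (π ⟨$⟩ʳ k) Fin.≟ j
  ... | no  _  = ℤ.*-zeroʳ ((P ᵀ *ᴹ M) i k)
  ... | yes eq = trans (ℤ.*-identityʳ _) (sum-zero _ (row k eq))

-- A zero block kills entries in one direction only; with both entries nonzero, neither order of `i`
-- and `j` can straddle it.
Joined : ∀ {n} → SquareMatrix n → Fin n → Fin n → Set
Joined N i j = N i j ≢ 0ℤ × N j i ≢ 0ℤ

-- Indices are coloured by the diagonal block to which the inverse of `π` sends them. Joined indices
-- of different colours would put a nonzero entry into the zero block.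
reducible⇒bipartition : ∀ {n} {N : SquareMatrix n} → Reducible N →
  Σ[ f ∈ (Fin n → Bool) ] ((∃[ i ] f i ≡ true) × (∃[ j ] f j ≡ false) ×
                            (∀ {i j} → Joined N i j → f i ≡ f j))
reducible⇒bipartition (reducible {p} {q} N π A B C N≡) =
  side ,
  (π ⟨$⟩ʳ top    , trans (cong part (inverseˡ π)) (cong isLeft (splitAt-↑ˡ p _ q))) ,
  (π ⟨$⟩ʳ bottom , trans (cong part (inverseˡ π)) (cong isLeft (splitAt-↑ʳ p q _))) ,
  joined
  where
  isLeft : Fin p ⊎ Fin q → Bool
  isLeft = [ const true , const false ]′

  part : Fin (p + q) → Bool
  part = isLeft ∘ splitAt p

  side : Fin (p + q) → Bool
  side i = part (π ⟨$⟩ˡ i)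

  -- The first index of each block: nonempty blocks make both colours occur.
  top bottom : Fin (p + q)
  top    = fromℕ< (>-nonZero⁻¹ p) ↑ˡ q
  bottom = p ↑ʳ fromℕ< (>-nonZero⁻¹ q)

  zeroBlock : ∀ k l → part k ≡ false → part l ≡ true → blockTriangular A B C k l ≡ 0ℤ
  -- `_++_` branches on the same `splitAt`, so the entry reduces to zero; the colour hypotheses
  -- exclude the omitted cases.
  zeroBlock k l _ _ with splitAt p k
  ... | inj₂ _ with splitAt p l
  ...   | inj₁ _ = refl

  zeroEntry : ∀ {i j} → side i ≡ false → side j ≡ true → N i j ≡ 0ℤ
  zeroEntry {i} {j} b t = trans (N≡ i j)
    (conjugate-zero π _ (zeroBlock (π ⟨$⟩ˡ i) (π ⟨$⟩ˡ j) b t))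

  joined : ∀ {i j} → Joined N i j → side i ≡ side j
  joined {i} {j} (ij , ji) with side i in eqᵢ | side j in eqⱼ
  ... | true  | true  = refl
  ... | false | false = refl
  ... | false | true  = contradiction (zeroEntry eqᵢ eqⱼ) ij
  ... | true  | false = contradiction (zeroEntry eqⱼ eqᵢ) ji

-- The colouring is constant along chains of joined indices, so it cannot take both values.
joined⇒irreducible : ∀ {n} {N : SquareMatrix n} →
  (∀ i j → EqClosure (Joined N) i j) → Irreducible N
joined⇒irreducible paths red with reducible⇒bipartition red
... | f , (i , fi) , (j , fj) , joined
  with () ← trans (sym fi) (trans (gfold isEquivalence f joined (paths i j)) fj)

snocʷ : ∀ {G u v w k} → Walk G u v k → Adj G v w → Walk G u w (suc k)
snocʷ {k = zero}  refl        b = _ , b , refl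
snocʷ {G} {k = suc k} (x , a , p) b = x , a , snocʷ {G} p b

-- Unlike `reverseʷ`, this keeps the length, as symmetry of `dist` requires.
walk-sym : ∀ {G u v k} → Walk G u v k → Walk G v u k
walk-sym {k = zero}      refl        = refl
walk-sym {G} {k = suc k} (x , a , p) = snocʷ {G} (walk-sym {G} p) (Graph.symm G a)

module _ (G : Graph) (conn : Connected G) where

  private
    d = dist G conn
    e = ecc G conn

  dist-least : ∀ u v → Least (Walk G u v) (d u v)
  dist-least u v = let k , walk = proj₂ conn u v in proj₂ (least (walk? G u v) k walk)

  dist-sym : ∀ u v → d u v ≡ d v u
  dist-sym u v = ℕ.≤-antisym (le u v) (le v u)
    where
    le : ∀ u v → d u v ≤ d v u
    le u v = proj₂ (dist-least u v) _ (walk-sym {G} (proj₁ (dist-least v u)))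

  dist≤ecc : ∀ u v → d u v ≤ e u
  dist≤ecc u v = subst (λ x → d u x ≤ e u) (vertex-number G v)
    (All.lookup (All.map⁻ (xs≤max 0 _)) (∈-allFin (number G v)))

  eccEntry≢0 : ∀ {u v} → d u v ≢ 0 → d u v ≡ e u ⊓ e v → eccEntry G conn u v ≢ 0ℤ
  eccEntry≢0 {u} {v} d≢0 eq rewrite dec-true (d u v ℕ.≟ e u ⊓ e v) eq = d≢0 ∘ ℤ.+-injective

  -- The hypotheses force `d u v` to be `e u`; since `e v` is at least `d v u`, which is the same
  -- number, the minimum of the eccentricities is `e u`. The form `suc k` keeps it positive.
  farthest⇒joined : ∀ {u v k} → (∀ x → ∃[ j ] (j ≤ suc k × Walk G u x j)) →
    (∀ j → Walk G u v j → suc k ≤ j) → eccEntry G conn u v ≢ 0ℤ × eccEntry G conn v u ≢ 0ℤ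
  farthest⇒joined {u} {v} {k} near far =
    eccEntry≢0 d≢0 d≡min ,
    eccEntry≢0 (d≢0 ∘ trans (dist-sym u v))
               (trans (dist-sym v u) (trans d≡min (ℕ.⊓-comm (e u) (e v))))
    where
    k<d : suc k ≤ d u v
    k<d = far _ (proj₁ (dist-least u v))

    d≢0 : d u v ≢ 0
    d≢0 = ℕ.m<n⇒n≢0 k<d

    ecc≤d : e u ≤ d u v
    -- `z≤n` covers the default value 0 of `max`.
    ecc≤d = max≤v⁺ z≤n (All.map⁺ (All.universal (λ i →
      let j , j≤k , p = near (vertex G i)
      in ℕ.≤-trans (proj₂ (dist-least u _) j p) (ℕ.≤-trans j≤k k<d)) (allFin (order G))))

    d≡ecc : d u v ≡ e u
    d≡ecc = ℕ.≤-antisym (dist≤ecc u v) ecc≤d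

    d≡min : d u v ≡ e u ⊓ e v
    d≡min = trans d≡ecc (sym (ℕ.m≤n⇒m⊓n≡m
      (ℕ.≤-trans ecc≤d (ℕ.≤-trans (ℕ.≤-reflexive (dist-sym u v)) (dist≤ecc v u)))))

-- Edges are positions in the list `edges`; this recovers an edge from its pair of ends.
lookup-injective : ∀ {A : Set} {xs : List A} → Unique xs →
  ∀ i j → lookup xs i ≡ lookup xs j → i ≡ j
lookup-injective {xs = _ ∷ _} _          zero    zero    _  = refl
lookup-injective {xs = _ ∷ _} (x∉ ∷ _)   zero    (suc j) eq = contradiction eq (All.lookup x∉ (∈-lookup j))
lookup-injective {xs = _ ∷ _} (x∉ ∷ _)   (suc i) zero    eq = contradiction (sym eq) (All.lookup x∉ (∈-lookup i))
lookup-injective {xs = _ ∷ _} (_  ∷ xs!) (suc i) (suc j) eq = cong suc (lookup-injective xs! i j eq)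

module _ (G : Graph) where

  edges-unique : Unique (edges G)
  edges-unique = filter⁺ (isEdge? G) (cartesianProduct⁺ (allFin⁺ _) (allFin⁺ _))

  edge-ordered : ∀ e → let i , j = lookup (edges G) e in i Fin.< j
  edge-ordered e = proj₁ (proj₂ (∈-filter⁻ (isEdge? G)
    {xs = cartesianProduct (allFin (order G)) (allFin (order G))} (∈-lookup e)))

  -- Both ends of `f` lie among the two ends of `e`, and each edge is listed with its ends in
  -- increasing order, so the pairs agree.
  spanning⇒unique : ∀ e → (∀ v → Incident G v e) → ∀ f → f ≡ e
  spanning⇒unique e span f = lookup-injective edges-unique f e
    (ends (span (end₁ G f)) (span (end₂ G f)) (edge-ordered f) (edge-ordered e))
    where
    inj = Injection.injective (↔⇒↣ (Graph.enum G))

    ends : ∀ {a b c d} →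
      vertex G a ≡ vertex G c ⊎ vertex G a ≡ vertex G d →
      vertex G b ≡ vertex G c ⊎ vertex G b ≡ vertex G d →
      a Fin.< b → c Fin.< d → (a , b) ≡ (c , d)
    ends (inj₁ p) (inj₂ q) _   _   = cong₂ _,_ (inj p) (inj q)
    ends (inj₁ p) (inj₁ q) a<b _   = contradiction a<b (<-irrefl (inj (trans p (sym q))))
    ends (inj₂ p) (inj₂ q) a<b _   = contradiction a<b (<-irrefl (inj (trans p (sym q))))
    ends (inj₂ p) (inj₁ q) a<b c<d with refl ← inj p | refl ← inj q = contradiction a<b (<-asym c<d)

theorem4p1 : (G₁ G₂ : Graph) (c₁ : Connected G₁) (c₂ : Connected G₂) (e₁ : HasEdge G₁) →
    Irreducible (ε (G₁ ⊻ G₂) (⊻-connected G₁ G₂ c₁ c₂ e₁))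
theorem4p1 G₁ G₂ c₁ c₂ e₁ = joined⇒irreducible λ i j → transitive _ (toHub i) (symmetric _ (toHub j))
  where
  J = G₁ ⊻ G₂
  conn = ⊻-connected G₁ G₂ c₁ c₂ e₁

  Link : Vertex J → Vertex J → Set
  Link u v = eccEntry J conn u v ≢ 0ℤ × eccEntry J conn v u ≢ 0ℤ

  original : Vertex G₁ → Vertex J
  original v = inj₁ (inj₁ v)

  subdividing : Edge G₁ → Vertex J
  subdividing e = inj₁ (inj₂ e)

  v₀ = proj₁ c₁
  w₀ = proj₁ c₂
  incident = incidentEdge G₁ c₁ e₁
  e₀ = proj₁ (incident v₀)

  join-link : ∀ w v → Link (inj₂ w) (original v)
  join-link w v = farthest⇒joined J conn near far
    where
    near : ∀ x → ∃[ j ] (j ≤ 2 × Walk J (inj₂ w) x j)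
    near (inj₁ (inj₁ v)) = let e , v∈e = incident v in
                           2 , ℕ.≤-refl , subdividing e , tt , original v , v∈e , refl
    near (inj₁ (inj₂ e)) = 1 , s≤s z≤n , subdividing e , tt , refl
    -- Any edge of `G₁` gives a common neighbour of all vertices of `G₂`; the walk may be longer
    -- than the distance.
    near (inj₂ z)        = 2 , ℕ.≤-refl , subdividing e₀ , tt , inj₂ z , tt , refl

    far : ∀ j → Walk J (inj₂ w) (original v) j → 2 ≤ j
    far 0             ()
    far 1             (_ , () , refl)
    far (suc (suc _)) _ = s≤s (s≤s z≤n)

  nonincident-link : ∀ e v → ¬ Incident G₁ v e → Link (subdividing e) (original v)
  nonincident-link e v v∉e = farthest⇒joined J conn near far
    where
    near : ∀ x → ∃[ j ] (j ≤ 3 × Walk J (subdividing e) x j)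
    -- `w₀` is adjacent to every subdivision vertex, hence leads from `e` to an edge at `v`.
    near (inj₁ (inj₁ v)) = let f , v∈f = incident v in
                           3 , ℕ.≤-refl , inj₂ w₀ , tt , subdividing f , tt , original v , v∈f , refl
    near (inj₁ (inj₂ f)) = 2 , s≤s (s≤s z≤n) , inj₂ w₀ , tt , subdividing f , tt , refl
    near (inj₂ z)        = 1 , s≤s z≤n , inj₂ z , tt , refl

    far : ∀ j → Walk J (subdividing e) (original v) j → 3 ≤ j
    far 0 ()
    far 1 (_ , v∈e , refl) = contradiction v∈e v∉e
    -- The middle vertex would have to be a subdivision vertex, as a neighbour of `v`, but no two of
    -- these are adjacent.
    far 2 (inj₁ (inj₁ _) , _  , _ , () , refl)
    far 2 (inj₁ (inj₂ _) , () , _)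
    far 2 (inj₂ _        , _  , _ , () , refl)
    far (suc (suc (suc _))) _ = s≤s (s≤s (s≤s z≤n))

  -- The K₂ case: `e` is the only edge, so its subdivision vertex has eccentricity 1 and is linked
  -- to the hub directly.
  spanning-link : ∀ e → (∀ v → Incident G₁ v e) → Link (subdividing e) (inj₂ w₀)
  spanning-link e span = farthest⇒joined J conn near far
    where
    near : ∀ x → ∃[ j ] (j ≤ 1 × Walk J (subdividing e) x j)
    near (inj₁ (inj₁ v)) = 1 , ℕ.≤-refl , original v , span v , refl
    near (inj₁ (inj₂ f)) = 0 , z≤n , cong subdividing (sym (spanning⇒unique G₁ e span f))
    near (inj₂ z)        = 1 , ℕ.≤-refl , inj₂ z , tt , refl

    far : ∀ j → Walk J (subdividing e) (inj₂ w₀) j → 1 ≤ j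
    far (suc _) _ = s≤s z≤n

  linked : ∀ x → EqClosure Link x (inj₂ w₀)
  linked (inj₁ (inj₁ v)) = symmetric _ (return (join-link w₀ v))
  -- Vertices of `G₂` reach the hub by way of `v₀` in `G₁`.
  linked (inj₂ w)        = transitive _ (return (join-link w v₀)) (linked (original v₀))
  linked (inj₁ (inj₂ e)) with Graph.anyVertex? G₁ (λ v → ¬? (incident? G₁ v e))
  ... | yes (v , v∉e) = transitive _ (return (nonincident-link e v v∉e)) (linked (original v))
  ... | no  ∄v = return (spanning-link e λ v → decidable-stable (incident? G₁ v e) λ v∉e → ∄v (v , v∉e))

  -- Links live on vertices, whereas reducibility speaks of matrix indices; `number` carries chains
  -- across.
  link⇒joined : ∀ {x y} → Link x y → Joined (ε J conn) (number J x) (number J y)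
  link⇒joined {x} {y} = subst₂ Link (sym (vertex-number J x)) (sym (vertex-number J y))

  toHub : ∀ i → EqClosure (Joined (ε J conn)) i (number J (inj₂ w₀))
  toHub i = subst (λ k → EqClosure (Joined (ε J conn)) k (number J (inj₂ w₀)))
    (Inverse.strictlyInverseʳ (Graph.enum J) i)
    (gmap (number J) (λ {x} {y} → link⇒joined {x} {y}) (linked (vertex J i)))
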